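{- For every $n:\mathbb N$, $\mathsf{FSAT}'(\mathbb 0;\{P^n\})\preceq\mathsf{FSAT}(\mathbb 0;\{\dot\in^2\})$. Here $(\mathbb 0;\{P^n\})$ is the signature with no function symbols and a single relation symbol $P$ of arity $n$, and $(\mathbb 0;\{\dot\in^2\})$ is the signature with no function symbols and a single binary relation symbol $\dot\in$.
   Context: We work in constructive type theory. $p\preceq q$ means there is a function $f$ with $p\,x\leftrightarrow q(f\,x)$ for all $x$. $\mathbb 0$ denotes the empty type. A type is finite if some list contains all of its elements, and discrete if its equality is decidable. Formulas are first-order formulas built from $\dot\bot$, atoms, $\dot\to,\dot\land,\dot\lor,\dot\forall,\dot\exists$. A model over a domain $D$ interprets relation symbols as predicates $D^{|P|}\to\mathbb P$, with Tarski satisfaction $\mathcal M\vDash_\rho\varphi$. The model is decidable if every relation interpretation is decidable. $\mathsf{FSAT}(\Sigma)\,\varphi$ holds iff some finite type $D$, decidable model over $D$ and assignment $\rho$ satisfy $\varphi$. $\mathsf{FSAT}'(\Sigma)\,\varphi$ additionally requires $D$ to be discrete. -}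

module Defs where

open import Level using (Level; 0ℓ; _⊔_)
open import Data.Empty using (⊥)
open import Data.List.Base using (List)
open import Data.List.Membership.Propositional using (_∈_)
open import Data.Nat.Base using (ℕ; zero; suc)
open import Data.Product.Base using (Σ-syntax; _×_)
open import Data.Sum.Base using (_⊎_)
open import Data.Unit.Base using (⊤)
open import Data.Vec.Base using (Vec; []; _∷_)
open import Function.Bundles using (_⇔_)
open import Relation.Binary.Definitions using (DecidableEquality)
open import Relation.Unary using (Pred; Decidable)

infix 4 _⪯_

_⪯_ : {a b p q : Level} {A : Set a} {B : Set b} →
      Pred A p → Pred B q → Set (a ⊔ b ⊔ p ⊔ q)
_⪯_ {A = A} {B = B} p q = Σ[ f ∈ (A → B) ] (∀ x → p x ⇔ q (f x))

Finite : Set → Set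
Finite A = Σ[ xs ∈ List A ] (∀ x → x ∈ xs)

record Signature : Set₁ where
  field
    Fun      : Set
    Rel      : Set
    funArity : Fun → ℕ
    relArity : Rel → ℕ

open Signature public

data Term (S : Signature) : Set where
  var : ℕ → Term S
  fun : (f : Fun S) → Vec (Term S) (funArity S f) → Term S

infixr 6 _∧̇_
infixr 5 _∨̇_
infixr 4 _→̇_

-- Variables are de Bruijn indices: ∀̇ and ∃̇ bind index 0 of their argument.
data Form (S : Signature) : Set where
  ⊥̇    : Form S
  atom : (P : Rel S) → Vec (Term S) (relArity S P) → Form S
  _→̇_ _∧̇_ _∨̇_ : Form S → Form S → Form S
  ∀̇ ∃̇ : Form S → Form S

-- The universe of propositions is rendered by Set.
record Model (S : Signature) (D : Set) : Set₁ where
  field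
    funᴹ : (f : Fun S) → Vec D (funArity S f) → D
    relᴹ : (P : Rel S) → Pred (Vec D (relArity S P)) 0ℓ

open Model public

DecidableModel : {S : Signature} {D : Set} → Model S D → Set
DecidableModel {S} M = (P : Rel S) → Decidable (relᴹ M P)

Assignment : Set → Set
Assignment D = ℕ → D

infixr 5 _·_

_·_ : {D : Set} → D → Assignment D → Assignment D
(a · ρ) zero    = a
(a · ρ) (suc i) = ρ i

module _ {S : Signature} {D : Set} (M : Model S D) where

  eval  : Assignment D → Term S → D
  evals : {n : ℕ} → Assignment D → Vec (Term S) n → Vec D n

  eval ρ (var i)    = ρ i
  eval ρ (fun f ts) = funᴹ M f (evals ρ ts)

  evals ρ []       = []
  evals ρ (t ∷ ts) = eval ρ t ∷ evals ρ ts

infix 3 _⊨[_]_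

_⊨[_]_ : {S : Signature} {D : Set} → Model S D → Assignment D → Form S → Set
M ⊨[ ρ ] ⊥̇         = ⊥
M ⊨[ ρ ] atom P ts = relᴹ M P (evals M ρ ts)
M ⊨[ ρ ] φ →̇ ψ     = (M ⊨[ ρ ] φ) → (M ⊨[ ρ ] ψ)
M ⊨[ ρ ] φ ∧̇ ψ     = (M ⊨[ ρ ] φ) × (M ⊨[ ρ ] ψ)
M ⊨[ ρ ] φ ∨̇ ψ     = (M ⊨[ ρ ] φ) ⊎ (M ⊨[ ρ ] ψ)
_⊨[_]_ {D = D} M ρ (∀̇ φ) = (a : D) → M ⊨[ a · ρ ] φ
_⊨[_]_ {D = D} M ρ (∃̇ φ) = Σ[ a ∈ D ] (M ⊨[ a · ρ ] φ)

FSAT : (S : Signature) → Form S → Set₁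
FSAT S φ = Σ[ D ∈ Set ] Finite D ×
           (Σ[ M ∈ Model S D ] DecidableModel M ×
            (Σ[ ρ ∈ Assignment D ] (M ⊨[ ρ ] φ)))

FSAT′ : (S : Signature) → Form S → Set₁
FSAT′ S φ = Σ[ D ∈ Set ] Finite D × DecidableEquality D ×
            (Σ[ M ∈ Model S D ] DecidableModel M ×
             (Σ[ ρ ∈ Assignment D ] (M ⊨[ ρ ] φ)))

oneRelation : ℕ → Signature
oneRelation n = record
  { Fun      = ⊥
  ; Rel      = ⊤
  ; funArity = λ ()
  ; relArity = λ _ → n
  }

{-# OPTIONS --safe #-}
-- Only atoms need translating: P(x₁,…,xₙ) becomes a fixed formula χ(x₁,…,xₙ)
-- over ∈, and every connective and quantifier is kept, without relativisation.
-- A model of the translation is then a model of the original formula, with χ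
-- as interpretation of P.  Conversely, a model over D is blown up to a model
-- over D, the words over D of length at most n, and one further point; the
-- added elements all count as copies of a fixed d₀ : D, so the collapse onto D
-- is a surjective strong homomorphism as soon as χ defines P up to this collapse.
-- In the blow-up the original elements are reflexive and the new ones are not;
-- this lets one relation encode equality of copies, "d is the head of w",
-- "v is the tail of w" and (from the further point) "P w".
-- Discreteness is free: every finite model pulls back along a surjection from
-- some Fin k, and formulas do not mention equality.
module Submission where

open import Defs
open import Data.Nat using (ℕ; zero; suc)
open import Data.Empty using (⊥; ⊥-elim)
open import Data.Fin.Base using (Fin)
import Data.Fin.Properties as Fin
open import Data.List.Base using (_∷_; [_]; _++_; map; length; lookup; allFin; cartesianProductWith)
open import Data.List.Membership.Propositional using (lose)
open import Data.List.Membership.Propositional.Properties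
  using (∈-allFin; ∈-map⁺; ∈-++⁺ˡ; ∈-++⁺ʳ; ∈-cartesianProductWith⁺)
open import Data.List.Relation.Unary.Any using (here; there; any?; index; satisfied)
open import Data.List.Relation.Unary.Any.Properties using (lookup-index)
open import Data.Product.Base using (Σ-syntax; _×_; _,_)
open import Data.Product.Function.NonDependent.Propositional using (_×-⇔_)
open import Data.Sum.Function.Propositional using (_⊎-⇔_)
open import Data.Unit.Base using (⊤; tt)
open import Data.Vec.Base as Vec using (Vec; []; _∷_)
open import Data.Vec.Properties using (map-∘)
open import Function.Base using (id; _∘_)
open import Function.Bundles using (_⇔_; mk⇔; module Equivalence)
open import Function.Construct.Composition using (_⇔-∘_)
open import Function.Construct.Identity using (⇔-id)
open import Function.Related.TypeIsomorphisms using (→-cong-⇔)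
open import Relation.Binary.Definitions using (DecidableEquality)
open import Relation.Binary.PropositionalEquality
  using (_≡_; refl; sym; trans; cong; cong₂; subst)
open import Relation.Nullary using (¬_; Dec; yes; no; ¬?; _×-dec_)
open import Relation.Nullary.Decidable using (map′)
open import Relation.Unary using (Pred; Decidable)
open import Level using (0ℓ)

open Equivalence using (to; from)

-- Logical equivalences and search over finite types

≡⇒⇔ : {A B : Set} → A ≡ B → A ⇔ B
≡⇒⇔ refl = ⇔-id _

Σ-cong-⇔ : {A : Set} {P Q : A → Set} → (∀ a → P a ⇔ Q a) → (Σ[ a ∈ A ] P a) ⇔ (Σ[ a ∈ A ] Q a)
Σ-cong-⇔ P⇔Q = mk⇔ (λ (a , p) → a , to (P⇔Q a) p) (λ (a , q) → a , from (P⇔Q a) q)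

any-finite? : {A : Set} {P : A → Set} → Finite A → Decidable P → Dec (Σ[ a ∈ A ] P a)
any-finite? (as , ∈as) P? = map′ satisfied (λ (a , p) → lose (∈as a) p) (any? P? as)

-- Surjective strong homomorphisms

module _ {S : Signature} {A B : Set} {M : Model S A} {N : Model S B} (h : A → B)
         (h-fun : ∀ f as → h (funᴹ M f as) ≡ funᴹ N f (Vec.map h as)) where

  eval-hom  : ∀ {ρ σ} → (∀ i → h (ρ i) ≡ σ i) → ∀ t → h (eval M ρ t) ≡ eval N σ t
  evals-hom : ∀ {ρ σ} → (∀ i → h (ρ i) ≡ σ i) →
              ∀ {n} (ts : Vec (Term S) n) → Vec.map h (evals M ρ ts) ≡ evals N σ ts

  eval-hom hρ≡σ (var i)    = hρ≡σ i
  eval-hom hρ≡σ (fun f ts) = trans (h-fun f _) (cong (funᴹ N f) (evals-hom hρ≡σ ts))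

  evals-hom hρ≡σ []       = refl
  evals-hom hρ≡σ (t ∷ ts) = cong₂ _∷_ (eval-hom hρ≡σ t) (evals-hom hρ≡σ ts)

  module _ (h-rel : ∀ P as → relᴹ M P as ⇔ relᴹ N P (Vec.map h as))
           (g : B → A) (h∘g : ∀ b → h (g b) ≡ b) where

    -- Implication is contravariant on the left, so both directions are proved together. The section
    -- `g` serves only the quantifiers: every `b` is the image of `g b`.
    ⊨-hom : ∀ φ {ρ σ} → (∀ i → h (ρ i) ≡ σ i) → (M ⊨[ ρ ] φ) ⇔ (N ⊨[ σ ] φ)
    ⊨-hom-· : ∀ φ {ρ σ} → (∀ i → h (ρ i) ≡ σ i) →
              ∀ {a b} → h a ≡ b → (M ⊨[ a · ρ ] φ) ⇔ (N ⊨[ b · σ ] φ)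

    ⊨-hom ⊥̇           hρ≡σ = ⇔-id _
    ⊨-hom (atom P ts) hρ≡σ = ≡⇒⇔ (cong (relᴹ N P) (evals-hom hρ≡σ ts)) ⇔-∘ h-rel P _
    ⊨-hom (φ →̇ ψ)     hρ≡σ = →-cong-⇔ (⊨-hom φ hρ≡σ) (⊨-hom ψ hρ≡σ)
    ⊨-hom (φ ∧̇ ψ)     hρ≡σ = ⊨-hom φ hρ≡σ ×-⇔ ⊨-hom ψ hρ≡σ
    ⊨-hom (φ ∨̇ ψ)     hρ≡σ = ⊨-hom φ hρ≡σ ⊎-⇔ ⊨-hom ψ hρ≡σ
    ⊨-hom (∀̇ φ)       hρ≡σ = mk⇔
      (λ all b → to (⊨-hom-· φ hρ≡σ (h∘g b)) (all (g b)))
      (λ all a → from (⊨-hom-· φ hρ≡σ refl) (all (h a)))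
    ⊨-hom (∃̇ φ)       hρ≡σ = mk⇔
      (λ (a , p) → h a , to (⊨-hom-· φ hρ≡σ refl) p)
      (λ (b , q) → g b , from (⊨-hom-· φ hρ≡σ (h∘g b)) q)

    ⊨-hom-· φ hρ≡σ ha≡b = ⊨-hom φ λ { zero → ha≡b ; (suc i) → hρ≡σ i }

-- The list may repeat elements, so `lookup` is merely surjective, with `index` choosing a preimage.
-- Pulling back along it takes no equality test on `D`.
FSAT⇒FSAT′ : ∀ {S} φ → FSAT S φ → FSAT′ S φ
FSAT⇒FSAT′ {S} φ (D , (ds , ∈ds) , M , M? , ρ , M⊨φ) =
  Fin (length ds) , (allFin _ , ∈-allFin) , Fin._≟_ , N , (λ P is → M? P _) , g ∘ ρ ,
  from (⊨-hom h (λ f is → h∘g _) (λ P is → ⇔-id _) g h∘g φ (λ i → h∘g (ρ i))) M⊨φ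
  where
  h : Fin (length ds) → D
  h = lookup ds

  g : D → Fin (length ds)
  g d = index (∈ds d)

  h∘g : ∀ d → h (g d) ≡ d
  h∘g d = sym (lookup-index (∈ds d))

  N : Model S (Fin (length ds))
  N = record { funᴹ = λ f is → g (funᴹ M f (Vec.map h is)) ; relᴹ = λ P is → relᴹ M P (Vec.map h is) }

-- The defining formula

module Path {E : Set} (R : E → E → Set) where

  -- In the blow-up, the reflexive `y` is the original element of which `x` is a copy. When `p` is a
  -- word, `R y p` makes `y` its head.
  Copy : E → E → Set
  Copy x p = Σ[ y ∈ E ] (R y y × R x y × R y p)

  -- Irreflexivity of `q` keeps the path off the original elements. A step follows even the last
  -- letter, and nothing is asked of the point where reading stops, so only a prefix is tested.
  Reads Next : ∀ {m} → Vec E m → E → Set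
  Reads []       p = ⊤
  Reads (x ∷ xs) p = Copy x p × Next xs p
  Next xs p = Σ[ q ∈ E ] (R p q × ¬ R q q × Reads xs q)

  Accepts : ∀ {m} → Vec E m → Set
  Accepts xs = Σ[ p ∈ E ] (¬ R p p × Next xs p)

  module _ (E-finite : Finite E) (R? : ∀ x y → Dec (R x y)) where

    reads? : ∀ {m} (xs : Vec E m) → Decidable (Reads xs)
    next?  : ∀ {m} (xs : Vec E m) → Decidable (Next xs)
    reads? []       p = yes tt
    reads? (x ∷ xs) p =
      any-finite? E-finite (λ y → R? y y ×-dec R? x y ×-dec R? y p) ×-dec next? xs p
    next? xs p = any-finite? E-finite λ q → R? p q ×-dec ¬? (R? q q) ×-dec reads? xs q

    -- Every existential ranges over the finite `E`; this makes the interpretation of `P` by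
    -- `Accepts` decidable.
    accepts? : ∀ {m} → Decidable (Accepts {m})
    accepts? xs = any-finite? E-finite λ p → ¬? (R? p p) ×-dec next? xs p

infix 7 _∈̇_

_∈̇_ : ℕ → ℕ → Form (oneRelation 2)
i ∈̇ j = atom tt (var i ∷ var j ∷ [])

¬̇_ : ∀ {S} → Form S → Form S
¬̇ φ = φ →̇ ⊥̇

readsḞ nextḞ : ∀ {m} → Vec ℕ m → ℕ → Form (oneRelation 2)
readsḞ []       p = ⊥̇ →̇ ⊥̇
readsḞ (x ∷ xs) p = ∃̇ (0 ∈̇ 0 ∧̇ suc x ∈̇ 0 ∧̇ 0 ∈̇ suc p) ∧̇ nextḞ xs p
nextḞ xs p = ∃̇ (suc p ∈̇ 0 ∧̇ ¬̇ (0 ∈̇ 0) ∧̇ readsḞ (Vec.map suc xs) 0)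

acceptsḞ : ∀ {m} → Vec ℕ m → Form (oneRelation 2)
acceptsḞ xs = ∃̇ (¬̇ (0 ∈̇ 0) ∧̇ nextḞ (Vec.map suc xs) 0)

module _ {E : Set} (M : Model (oneRelation 2) E) where

  open Path {E} (λ x y → relᴹ M tt (x ∷ y ∷ []))

  -- Satisfaction computes to the clauses of `Path`; what remains is that shifted variables keep
  -- their values in the extended assignment.
  ⊨-reads : ∀ {m} (xs : Vec ℕ m) p {ρ} → (M ⊨[ ρ ] readsḞ xs p) ⇔ Reads (Vec.map ρ xs) (ρ p)
  ⊨-next  : ∀ {m} (xs : Vec ℕ m) p {ρ} → (M ⊨[ ρ ] nextḞ xs p) ⇔ Next (Vec.map ρ xs) (ρ p)
  ⊨-reads []       p = mk⇔ _ (λ _ → id)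
  ⊨-reads (x ∷ xs) p = ⇔-id _ ×-⇔ ⊨-next xs p
  ⊨-next xs p {ρ} = Σ-cong-⇔ λ q → ⇔-id _ ×-⇔ (⇔-id _ ×-⇔
    (≡⇒⇔ (cong (λ as → Reads as q) (sym (map-∘ (q · ρ) suc xs))) ⇔-∘ ⊨-reads (Vec.map suc xs) 0))

  ⊨-accepts : ∀ {m} (xs : Vec ℕ m) {ρ} → (M ⊨[ ρ ] acceptsḞ xs) ⇔ Accepts (Vec.map ρ xs)
  ⊨-accepts xs {ρ} = Σ-cong-⇔ λ p → ⇔-id _ ×-⇔
    (≡⇒⇔ (cong (λ as → Next as p) (sym (map-∘ (p · ρ) suc xs))) ⇔-∘ ⊨-next (Vec.map suc xs) 0)

-- Translation of formulas

index-of : ∀ {n} → Term (oneRelation n) → ℕ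
index-of (var i) = i

translate : ∀ {n} → Form (oneRelation n) → Form (oneRelation 2)
translate ⊥̇           = ⊥̇
translate (atom P ts) = acceptsḞ (Vec.map index-of ts)
translate (φ →̇ ψ)     = translate φ →̇ translate ψ
translate (φ ∧̇ ψ)     = translate φ ∧̇ translate ψ
translate (φ ∨̇ ψ)     = translate φ ∨̇ translate ψ
translate (∀̇ φ)       = ∀̇ (translate φ)
translate (∃̇ φ)       = ∃̇ (translate φ)

relationalModel : ∀ {n} {E : Set} → Pred (Vec E n) 0ℓ → Model (oneRelation n) E
relationalModel P = record { funᴹ = λ () ; relᴹ = λ _ → P }

acceptsModel : ∀ n {E : Set} → Model (oneRelation 2) E → Model (oneRelation n) E
acceptsModel n M = relationalModel (Path.Accepts λ x y → relᴹ M tt (x ∷ y ∷ []))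

evals-index-of : ∀ {n m} {E : Set} (M : Model (oneRelation n) E) ρ (ts : Vec (Term (oneRelation n)) m) →
                 Vec.map ρ (Vec.map index-of ts) ≡ evals M ρ ts
evals-index-of M ρ []           = refl
evals-index-of M ρ (var i ∷ ts) = cong (ρ i ∷_) (evals-index-of M ρ ts)

⊨-translate : ∀ {n} {E : Set} (M : Model (oneRelation 2) E) φ {ρ} →
              (M ⊨[ ρ ] translate φ) ⇔ (acceptsModel n M ⊨[ ρ ] φ)
⊨-translate M ⊥̇ = ⇔-id _
⊨-translate {n} M (atom P ts) {ρ} =
  ≡⇒⇔ (cong (relᴹ (acceptsModel n M) P) (evals-index-of (acceptsModel n M) ρ ts))
  ⇔-∘ ⊨-accepts M (Vec.map index-of ts)
⊨-translate M (φ →̇ ψ) = →-cong-⇔ (⊨-translate M φ) (⊨-translate M ψ)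
⊨-translate M (φ ∧̇ ψ) = ⊨-translate M φ ×-⇔ ⊨-translate M ψ
⊨-translate M (φ ∨̇ ψ) = ⊨-translate M φ ⊎-⇔ ⊨-translate M ψ
⊨-translate M (∀̇ φ)   = mk⇔ (λ p a → to (⊨-translate M φ) (p a)) (λ p a → from (⊨-translate M φ) (p a))
⊨-translate M (∃̇ φ)   = Σ-cong-⇔ λ a → ⊨-translate M φ

-- Words of bounded length

infixr 5 _◂_

-- The index only bounds the length, so one type holds the words together with their tails. A tail
-- comes with a smaller bound, hence `weaken` and a comparison `_≈_` across bounds.
data Word (D : Set) : ℕ → Set where
  ε   : ∀ {k} → Word D k
  _◂_ : ∀ {k} → D → Word D k → Word D (suc k)

module _ {D : Set} where

  weaken : ∀ {k} → Word D k → Word D (suc k)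
  weaken ε       = ε
  weaken (d ◂ w) = d ◂ weaken w

  fromVec : ∀ {k} → Vec D k → Word D k
  fromVec []       = ε
  fromVec (d ∷ ds) = d ◂ fromVec ds

  infix 4 _≈_

  _≈_ : ∀ {j k} → Word D j → Word D k → Set
  ε       ≈ ε       = ⊤
  (d ◂ v) ≈ (e ◂ w) = d ≡ e × v ≈ w
  _       ≈ _       = ⊥

  Head : ∀ {k} → D → Word D k → Set
  Head d ε       = ⊥
  Head d (e ◂ _) = d ≡ e

  Tail : ∀ {j k} → Word D j → Word D k → Set
  Tail ε       _ = ⊥
  Tail (_ ◂ v) w = v ≈ w

  Prefix : ∀ {m k} → Vec D m → Word D k → Set
  Prefix []       w       = ⊤
  Prefix (_ ∷ _)  ε       = ⊥
  Prefix (d ∷ ds) (e ◂ w) = d ≡ e × Prefix ds w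

  -- Each letter fixes the first argument of `P`; a word that stops short of the bound is rejected.
  FullIn : ∀ {k} → Pred (Vec D k) 0ℓ → Word D k → Set
  FullIn {zero}  P ε       = P []
  FullIn {suc k} P ε       = ⊥
  FullIn         P (d ◂ w) = FullIn (P ∘ (d ∷_)) w

  ≈-weaken : ∀ {k} (w : Word D k) → w ≈ weaken w
  ≈-weaken ε       = tt
  ≈-weaken (d ◂ w) = refl , ≈-weaken w

  ≉-◂ : ∀ {k} d (w : Word D k) → ¬ (w ≈ (d ◂ w))
  ≉-◂ d (e ◂ w) (_ , w≈) = ≉-◂ e w w≈

  -- A word differs in length from its tail. This makes the word points irreflexive, hence
  -- distinguishable from the original elements.
  Tail-irrefl : ∀ {k} (w : Word D k) → ¬ Tail w w
  Tail-irrefl (d ◂ w) = ≉-◂ d w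

  Prefix-resp-≈ : ∀ {m j k} (ds : Vec D m) (v : Word D j) (w : Word D k) →
                  v ≈ w → Prefix ds v ⇔ Prefix ds w
  Prefix-resp-≈ []       v       w       _            = ⇔-id _
  Prefix-resp-≈ (d ∷ ds) ε       ε       _            = ⇔-id _
  Prefix-resp-≈ (d ∷ ds) (e ◂ v) (_ ◂ w) (refl , v≈w) = ⇔-id _ ×-⇔ Prefix-resp-≈ ds v w v≈w

  Prefix-too-long : ∀ {k} (ds : Vec D (suc k)) (w : Word D k) → ¬ Prefix ds w
  Prefix-too-long (d ∷ ds) (e ◂ w) (_ , p) = Prefix-too-long ds w p

  -- The tail of `v` lives under a bound below `k`, too small for `k` letters.
  ¬Prefix-Tail : ∀ {k} (ds : Vec D k) (v w : Word D k) → Tail v w → ¬ Prefix ds w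
  ¬Prefix-Tail ds (d ◂ v) w v≈w p = Prefix-too-long ds v (from (Prefix-resp-≈ ds v w v≈w) p)

  -- A full word is as long as `ds`, so the prefix is the whole word.
  FullIn-Prefix : ∀ {k} {P : Pred (Vec D k) 0ℓ} ds (w : Word D k) → FullIn P w → Prefix ds w → P ds
  FullIn-Prefix []       ε       f _          = f
  FullIn-Prefix (d ∷ ds) (_ ◂ w) f (refl , p) = FullIn-Prefix ds w f p

  FullIn-fromVec : ∀ {k} {P : Pred (Vec D k) 0ℓ} ds → P ds → FullIn P (fromVec ds)
  FullIn-fromVec []       p = p
  FullIn-fromVec (d ∷ ds) p = FullIn-fromVec ds p

  Prefix-fromVec : ∀ {k} (ds : Vec D k) → Prefix ds (fromVec ds)
  Prefix-fromVec []       = tt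
  Prefix-fromVec (d ∷ ds) = refl , Prefix-fromVec ds

  FullIn? : ∀ {k} {P : Pred (Vec D k) 0ℓ} → Decidable P → Decidable (FullIn P)
  FullIn? {zero}  P? ε       = P? []
  FullIn? {suc k} P? ε       = no id
  FullIn?         P? (d ◂ w) = FullIn? (P? ∘ (d ∷_)) w

  module _ (_≟_ : DecidableEquality D) where

    ≈? : ∀ {j k} (v : Word D j) (w : Word D k) → Dec (v ≈ w)
    ≈? ε       ε       = yes tt
    ≈? ε       (_ ◂ _) = no id
    ≈? (_ ◂ _) ε       = no id
    ≈? (d ◂ v) (e ◂ w) = d ≟ e ×-dec ≈? v w

    Head? : ∀ {k} d (w : Word D k) → Dec (Head d w)
    Head? d ε       = no id
    Head? d (e ◂ _) = d ≟ e

    Tail? : ∀ {j k} (v : Word D j) (w : Word D k) → Dec (Tail v w)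
    Tail? ε       w = no id
    Tail? (_ ◂ v) w = ≈? v w

Word-finite : ∀ {D} → Finite D → ∀ k → Finite (Word D k)
Word-finite D-finite zero = [ ε ] , λ { ε → here refl }
Word-finite D-finite@(ds , ∈ds) (suc k) =
  let ws , ∈ws = Word-finite D-finite k in
  ε ∷ cartesianProductWith _◂_ ds ws ,
  λ { ε → here refl ; (d ◂ w) → there (∈-cartesianProductWith⁺ _◂_ (∈ds d) (∈ws w)) }

-- The blow-up of a model

data Blowup (D : Set) (n : ℕ) : Set where
  elt   : D → Blowup D n
  start : Blowup D n
  word  : Word D n → Blowup D n

Blowup-finite : ∀ {D n} → Finite D → Finite (Blowup D n)
Blowup-finite {n = n} D-finite@(ds , ∈ds) =
  let ws , ∈ws = Word-finite D-finite n in
  start ∷ map elt ds ++ map word ws ,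
  λ { (elt d)  → there (∈-++⁺ˡ (∈-map⁺ elt (∈ds d)))
    ; start    → here refl
    ; (word w) → there (∈-++⁺ʳ (map elt ds) (∈-map⁺ word (∈ws w))) }

module _ {D : Set} {n : ℕ} (d₀ : D) (P : Pred (Vec D n) 0ℓ) where

  collapse : Blowup D n → D
  collapse (elt d) = d
  collapse _       = d₀

  -- Nothing enters `start`, so it is irreflexive and can only be the first point of a path.
  Edge : Blowup D n → Blowup D n → Set
  Edge x        (elt d)  = collapse x ≡ d
  Edge _        start    = ⊥
  Edge (elt d)  (word w) = Head d w
  Edge start    (word w) = FullIn P w
  Edge (word v) (word w) = Tail v w

  Edge? : DecidableEquality D → Decidable P → ∀ x y → Dec (Edge x y)
  Edge? _≟_ P? x        (elt d)  = collapse x ≟ d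
  Edge? _≟_ P? _        start    = no id
  Edge? _≟_ P? (elt d)  (word w) = Head? _≟_ d w
  Edge? _≟_ P? start    (word w) = FullIn? P? w
  Edge? _≟_ P? (word v) (word w) = Tail? _≟_ v w

  open Path Edge

  -- The middle point of a `Copy` is reflexive, so it is an original element, and the edge from `x`
  -- fixes it as `collapse x`.
  Copy⇔Head : ∀ x w → Copy x (word w) ⇔ Head (collapse x) w
  Copy⇔Head x w = mk⇔
    (λ { (elt d , _ , x~d , h) → subst (λ e → Head e w) (sym x~d) h
       ; (word v , v→v , _) → ⊥-elim (Tail-irrefl v v→v) })
    (λ h → elt (collapse x) , refl , refl , h)

  Reads⇒Prefix : ∀ {m} (xs : Vec (Blowup D n) m) w → Reads xs (word w) → Prefix (Vec.map collapse xs) w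
  Reads⇒Prefix [] w _ = tt
  -- Original elements are reflexive and `start` has no incoming edge, so the next point is a word.
  Reads⇒Prefix (x ∷ xs) w (_ , elt d , _ , irr , _) = ⊥-elim (irr refl)
  Reads⇒Prefix (x ∷ xs) (d ◂ v) (c , word w , v≈w , _ , r) =
    to (Copy⇔Head x (d ◂ v)) c , from (Prefix-resp-≈ _ v w v≈w) (Reads⇒Prefix xs w r)

  Prefix⇒Reads : ∀ {m} (xs : Vec (Blowup D n) m) w → Prefix (Vec.map collapse xs) w → Reads xs (word w)
  Prefix⇒Reads [] w _ = tt
  Prefix⇒Reads (x ∷ xs) (d ◂ v) (h , p) =
    -- The tail `v` has too small a bound to be a point of the blow-up; `weaken v` is the same word
    -- under the bound `n`.
    from (Copy⇔Head x (d ◂ v)) h , word (weaken v) , ≈-weaken v , Tail-irrefl (weaken v) ,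
    Prefix⇒Reads xs (weaken v) (to (Prefix-resp-≈ _ v (weaken v) (≈-weaken v)) p)

  -- A path reading n elements and starting at a word would first step to a tail,
  -- which has length less than n; so it starts at the point start.
  Accepts⇔P : ∀ (xs : Vec (Blowup D n) n) → Accepts xs ⇔ P (Vec.map collapse xs)
  Accepts⇔P xs = mk⇔ accepts⇒P λ p →
    let w = fromVec (Vec.map collapse xs) in
    start , id , word w , FullIn-fromVec (Vec.map collapse xs) p , Tail-irrefl w , Prefix⇒Reads xs w (Prefix-fromVec _)
    where
    accepts⇒P : Accepts xs → P (Vec.map collapse xs)
    accepts⇒P (elt _ , irr , _) = ⊥-elim (irr refl)
    accepts⇒P (_ , _ , elt _ , _ , irr , _) = ⊥-elim (irr refl)
    accepts⇒P (start , _ , word w , f , _ , r) = FullIn-Prefix _ w f (Reads⇒Prefix xs w r)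
    accepts⇒P (word v , _ , word w , t , _ , r) = ⊥-elim (¬Prefix-Tail _ v w t (Reads⇒Prefix xs w r))

  blowupModel : Model (oneRelation 2) (Blowup D n)
  blowupModel = relationalModel λ { (x ∷ y ∷ []) → Edge x y }

theorem26 : (n : ℕ) → FSAT′ (oneRelation n) ⪯ FSAT (oneRelation 2)
-- A model of the translation need not be discrete, so `FSAT⇒FSAT′` is applied after `back`.
theorem26 n = translate , λ φ → mk⇔ (forth φ) (FSAT⇒FSAT′ φ ∘ back φ)
  where
  forth : ∀ φ → FSAT′ (oneRelation n) φ → FSAT (oneRelation 2) (translate φ)
  forth φ (D , D-finite , _≟_ , M , M? , ρ , M⊨φ) =
    Blowup D n , Blowup-finite D-finite , N ,
    (λ { tt (x ∷ y ∷ []) → Edge? d₀ P _≟_ (M? tt) x y }) , elt ∘ ρ ,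
    from (⊨-translate N φ)
      (from (⊨-hom (collapse d₀ P) (λ ()) (λ _ → Accepts⇔P d₀ P) elt (λ _ → refl) φ (λ _ → refl)) M⊨φ)
    where
    -- The assignment shows that `D` is inhabited; any element would do.
    d₀ = ρ 0
    P  = relᴹ M tt
    N  = blowupModel d₀ P

  back : ∀ φ → FSAT (oneRelation 2) (translate φ) → FSAT (oneRelation n) φ
  back φ (E , E-finite , N , N? , ρ , N⊨φ) =
    E , E-finite , acceptsModel n N ,
    (λ _ → Path.accepts? _ E-finite (λ x y → N? tt (x ∷ y ∷ []))) , ρ , to (⊨-translate N φ) N⊨φ
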